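{- Let $t,s$ be independent indeterminates and let $f_m(t,s)\in\mathbb{Q}(t,s)$ be the coefficients in $F_{t,s}(u)=\sum_{m\ge0}f_m(t,s)u^m$, so $f_0(t,s)=1$. For $m\ge1$, $$m\,f_m(t,s)=-2\sum_{\substack{1\le j\le m\\ j\text{ odd}}}\frac{1-s^j}{1-t^j}\,f_{m-j}(t,s).$$
   Context: $$F_{t,s}(u)=\exp\Big(-2\sum_{n\ge1,\ n\text{ odd}}\frac{1-s^n}{1-t^n}\frac{u^n}{n}\Big)\in\mathbb{Q}(t,s)[[u]].$$ -}

module Defs where

open import Level using (Level; _⊔_; 0ℓ) renaming (suc to lsuc)
open import Algebra.Bundles using (CommutativeRing)
open import Algebra.Morphism.Structures using (module RingMorphisms)
import Algebra.Morphism.Construct.Composition as Composition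
import Algebra.Properties.Group
import Algebra.Properties.Ring
import Algebra.Properties.Semiring.Exp
import Algebra.Properties.Semiring.Mult
import Algebra.Properties.Semiring.Sum
import Algebra.Solver.Ring.NaturalCoefficients.Default as Solver
open import Data.Bool.Base using (Bool; if_then_else_; not)
open import Data.Fin.Base using (Fin; toℕ)
import Data.Integer.Base as ℤ
open import Data.Nat.Base as ℕ using (ℕ; zero; suc; _∸_; _≤_; _<_; z≤n; s≤s; NonZero; _!)
import Data.Nat.Properties as ℕ
open import Data.Nat.Divisibility using (_∣?_)
open import Data.Product.Base using (∃; _,_; _×_)
open import Data.Rational.Base as ℚ using (ℚ; 0ℚ; 1ℚ)
import Data.Rational.Properties as ℚ
open import Data.Sum.Base using (_⊎_; inj₁; inj₂)
open import Function.Base using (_∘_; case_of_)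
open import Relation.Binary.Definitions using (Decidable)
open import Relation.Binary.PropositionalEquality as ≡ using (_≡_)
import Relation.Binary.Reasoning.Setoid as SetoidReasoning
open import Relation.Nullary.Decidable using (yes; no; does; map′)
open import Relation.Nullary.Negation using (¬_; contradiction)

private
  variable
    c ℓ : Level

record IntegralDomain c ℓ : Set (lsuc (c ⊔ ℓ)) where
  field
    commutativeRing : CommutativeRing c ℓ

  open CommutativeRing commutativeRing public

  -- Decidability makes "x ≉ 0 and y ≉ 0 imply x * y ≉ 0" equivalent to the
  -- disjunctive form of having no zero divisors.
  field
    _≟_       : Decidable _≈_
    1≉0       : ¬ (1# ≈ 0#)
    *-nonzero : ∀ {x y} → ¬ (x ≈ 0#) → ¬ (y ≈ 0#) → ¬ (x * y ≈ 0#)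

  *-cancelʳ : ∀ {x y z} → ¬ (z ≈ 0#) → x * z ≈ y * z → x ≈ y
  *-cancelʳ {x} {y} {z} z≉0 xz≈yz with (x - y) ≟ 0#
  ... | yes x-y≈0 = x∙y⁻¹≈ε⇒x≈y x y x-y≈0
    where open Algebra.Properties.Group +-group
  ... | no x-y≉0 = contradiction x-y*z≈0 (*-nonzero x-y≉0 z≉0)
    where
    open SetoidReasoning setoid
    open Algebra.Properties.Ring ring using (-‿distribˡ-*)
    x-y*z≈0 : (x - y) * z ≈ 0#
    x-y*z≈0 = begin
      (x - y) * z        ≈⟨ distribʳ z x (- y) ⟩
      x * z + - y * z    ≈⟨ +-congˡ (-‿distribˡ-* y z) ⟨
      x * z - y * z      ≈⟨ +-congʳ xz≈yz ⟩
      y * z - y * z      ≈⟨ -‿inverseʳ (y * z) ⟩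
      0#                 ∎

-- Formal power series R[[u]]: n ↦ the coefficient of uⁿ
module PowerSeries (R : CommutativeRing c ℓ) where

  private module R = CommutativeRing R
  open R using (Carrier; _≈_; _+_; _*_; -_; 0#; 1#)
  open Algebra.Properties.Semiring.Sum R.semiring
  open SetoidReasoning R.setoid

  Series : Set c
  Series = ℕ → Carrier

  infix  4 _≈ₛ_
  infixl 6 _+ₛ_
  infixl 7 _*ₛ_

  _≈ₛ_ : Series → Series → Set ℓ
  a ≈ₛ b = ∀ n → a n ≈ b n

  _+ₛ_ _*ₛ_ : Series → Series → Series
  (a +ₛ b) n = a n + b n
  (a *ₛ b) n = ∑[ i ≤ n ] (a (toℕ i) * b (n ∸ toℕ i))

  -ₛ_ : Series → Series
  (-ₛ a) n = - a n

  constant : Carrier → Series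
  constant x zero    = x
  constant x (suc n) = 0#

  0ₛ 1ₛ : Series
  0ₛ _ = 0#
  1ₛ   = constant 1#

  *ₛ-cong : ∀ {a a′ b b′} → a ≈ₛ a′ → b ≈ₛ b′ → a *ₛ b ≈ₛ a′ *ₛ b′
  *ₛ-cong a≈ b≈ n = sum-cong-≋ {suc n} (λ i → R.*-cong (a≈ (toℕ i)) (b≈ (n ∸ toℕ i)))

  *ₛ-zeroˡ : ∀ {a} b → a ≈ₛ 0ₛ → a *ₛ b ≈ₛ 0ₛ
  *ₛ-zeroˡ b a≈0 zero =
    R.trans (R.+-identityʳ _) (R.trans (R.*-congʳ (a≈0 0)) (R.zeroˡ _))
  *ₛ-zeroˡ {a} b a≈0 (suc n) = begin
    a 0 * b (suc n) + (a ∘ suc *ₛ b) n ≈⟨ R.+-cong (R.*-congʳ (a≈0 0)) (*ₛ-zeroˡ b (a≈0 ∘ suc) n) ⟩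
    0# * b (suc n) + 0#                ≈⟨ R.+-identityʳ _ ⟩
    0# * b (suc n)                     ≈⟨ R.zeroˡ _ ⟩
    0#                                 ∎

  constant-*ₛ : ∀ x b n → (constant x *ₛ b) n ≈ x * b n
  constant-*ₛ x b zero    = R.+-identityʳ _
  constant-*ₛ x b (suc n) =
    R.trans (R.+-congˡ (*ₛ-zeroˡ {0ₛ} b (λ _ → R.refl) n)) (R.+-identityʳ _)

  *ₛ-distribʳ : ∀ c a b → (a +ₛ b) *ₛ c ≈ₛ a *ₛ c +ₛ b *ₛ c
  *ₛ-distribʳ c a b n = R.trans
    (sum-cong-≋ {suc n} (λ i → R.distribʳ (c (n ∸ toℕ i)) (a (toℕ i)) (b (toℕ i))))
    (∑-distrib-+ {suc n} (λ i → a (toℕ i) * c (n ∸ toℕ i)) (λ i → b (toℕ i) * c (n ∸ toℕ i)))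

  -- Peeling off the last term of the Cauchy product; peeling off the first
  -- term holds by definition.
  *ₛ-last : ∀ a b n → (a *ₛ b) (suc n) ≈ (a *ₛ (b ∘ suc)) n + a (suc n) * b 0
  *ₛ-last a b zero = begin
    a 0 * b 1 + (a 1 * b 0 + 0#)  ≈⟨ R.+-congˡ (R.+-identityʳ _) ⟩
    a 0 * b 1 + a 1 * b 0         ≈⟨ R.+-congʳ (R.+-identityʳ _) ⟨
    (a 0 * b 1 + 0#) + a 1 * b 0  ∎
  *ₛ-last a b (suc n) = R.trans (R.+-congˡ (*ₛ-last (a ∘ suc) b n)) (R.sym (R.+-assoc _ _ _))

  *ₛ-comm : ∀ a b → a *ₛ b ≈ₛ b *ₛ a
  *ₛ-comm a b zero    = R.+-congʳ (R.*-comm _ _)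
  *ₛ-comm a b (suc n) = begin
    a 0 * b (suc n) + (a ∘ suc *ₛ b) n ≈⟨ R.+-cong (R.*-comm _ _) (*ₛ-comm (a ∘ suc) b n) ⟩
    b (suc n) * a 0 + (b *ₛ a ∘ suc) n ≈⟨ R.+-comm _ _ ⟩
    (b *ₛ a ∘ suc) n + b (suc n) * a 0 ≈⟨ *ₛ-last b a n ⟨
    (b *ₛ a) (suc n)                   ∎

  *ₛ-scale : ∀ x a b n → ((λ k → x * a k) *ₛ b) n ≈ x * (a *ₛ b) n
  *ₛ-scale x a b n = R.trans
    (sum-cong-≋ {suc n} (λ i → R.*-assoc x (a (toℕ i)) (b (n ∸ toℕ i))))
    (R.sym (*-distribˡ-sum {suc n} x (λ i → a (toℕ i) * b (n ∸ toℕ i))))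

  *ₛ-assoc : ∀ a b c → (a *ₛ b) *ₛ c ≈ₛ a *ₛ (b *ₛ c)
  *ₛ-assoc a b c zero = begin
    (a 0 * b 0 + 0#) * c 0 + 0#   ≈⟨ R.+-congʳ (R.*-congʳ (R.+-identityʳ _)) ⟩
    a 0 * b 0 * c 0 + 0#          ≈⟨ R.+-congʳ (R.*-assoc _ _ _) ⟩
    a 0 * (b 0 * c 0) + 0#        ≈⟨ R.+-congʳ (R.*-congˡ (R.+-identityʳ _)) ⟨
    a 0 * (b 0 * c 0 + 0#) + 0#   ∎
  *ₛ-assoc a b c (suc n) = begin
    (a 0 * b 0 + 0#) * c (suc n) + (((λ k → a 0 * b (suc k)) +ₛ a ∘ suc *ₛ b) *ₛ c) n
      ≈⟨ R.+-cong (R.*-congʳ (R.+-identityʳ _)) (*ₛ-distribʳ c (λ k → a 0 * b (suc k)) (a ∘ suc *ₛ b) n) ⟩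
    a 0 * b 0 * c (suc n) + (((λ k → a 0 * b (suc k)) *ₛ c) n + ((a ∘ suc *ₛ b) *ₛ c) n)
      ≈⟨ R.+-cong (R.*-assoc _ _ _) (R.+-cong (*ₛ-scale (a 0) (b ∘ suc) c n) (*ₛ-assoc (a ∘ suc) b c n)) ⟩
    a 0 * (b 0 * c (suc n)) + (a 0 * (b ∘ suc *ₛ c) n + (a ∘ suc *ₛ (b *ₛ c)) n)
      ≈⟨ R.+-assoc _ _ _ ⟨
    a 0 * (b 0 * c (suc n)) + a 0 * (b ∘ suc *ₛ c) n + (a ∘ suc *ₛ (b *ₛ c)) n
      ≈⟨ R.+-congʳ (R.distribˡ _ _ _) ⟨
    a 0 * (b *ₛ c) (suc n) + (a ∘ suc *ₛ (b *ₛ c)) n ∎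

  *ₛ-identityˡ : ∀ a → 1ₛ *ₛ a ≈ₛ a
  *ₛ-identityˡ a n = R.trans (constant-*ₛ 1# a n) (R.*-identityˡ (a n))

  commutativeRing : CommutativeRing c ℓ
  commutativeRing = record
    { Carrier = Series
    ; _≈_ = _≈ₛ_
    ; _+_ = _+ₛ_
    ; _*_ = _*ₛ_
    ; -_  = -ₛ_
    ; 0#  = 0ₛ
    ; 1#  = 1ₛ
    ; isCommutativeRing = record
      { isRing = record
        { +-isAbelianGroup = record
          { isGroup = record
            { isMonoid = record
              { isSemigroup = record
                { isMagma = record
                  { isEquivalence = record
                    { refl  = λ n → R.refl
                    ; sym   = λ p n → R.sym (p n)
                    ; trans = λ p q n → R.trans (p n) (q n)
                    }
                  ; ∙-cong = λ p q n → R.+-cong (p n) (q n)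
                  }
                ; assoc = λ a b c n → R.+-assoc (a n) (b n) (c n)
                }
              ; identity = (λ a n → R.+-identityˡ (a n)) , (λ a n → R.+-identityʳ (a n))
              }
            ; inverse = (λ a n → R.-‿inverseˡ (a n)) , (λ a n → R.-‿inverseʳ (a n))
            ; ⁻¹-cong = λ p n → R.-‿cong (p n)
            }
          ; comm = λ a b n → R.+-comm (a n) (b n)
          }
        ; *-cong = *ₛ-cong
        ; *-assoc = *ₛ-assoc
        ; *-identity = *ₛ-identityˡ , (λ a n → R.trans (*ₛ-comm a 1ₛ n) (*ₛ-identityˡ a n))
        ; distrib = (λ c a b n → R.trans (*ₛ-comm c (a +ₛ b) n)
                      (R.trans (*ₛ-distribʳ c a b n) (R.+-cong (*ₛ-comm a c n) (*ₛ-comm b c n))))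
                  , *ₛ-distribʳ
        }
      ; *-comm = *ₛ-comm
      }
    }

  open Algebra.Properties.Semiring.Exp (CommutativeRing.semiring commutativeRing)

  ^-vanish : ∀ {a} → a 0 ≈ 0# → ∀ k m → m < k → (a ^ k) m ≈ 0#
  ^-vanish {a} a₀≈0 (suc k) zero    _         = begin
    a 0 * (a ^ k) 0 + 0#  ≈⟨ R.+-identityʳ _ ⟩
    a 0 * (a ^ k) 0       ≈⟨ R.*-congʳ a₀≈0 ⟩
    0# * (a ^ k) 0        ≈⟨ R.zeroˡ _ ⟩
    0#                    ∎
  ^-vanish {a} a₀≈0 (suc k) (suc m) (s≤s m<k) = begin
    a 0 * (a ^ k) (suc m) + (a ∘ suc *ₛ a ^ k) m  ≈⟨ R.+-cong (R.*-congʳ a₀≈0) tail≈0 ⟩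
    0# * (a ^ k) (suc m) + 0#                     ≈⟨ R.+-identityʳ _ ⟩
    0# * (a ^ k) (suc m)                          ≈⟨ R.zeroˡ _ ⟩
    0#                                            ∎
    where
    vanish : ∀ (i : Fin (suc m)) → a (suc (toℕ i)) * (a ^ k) (m ∸ toℕ i) ≈ 0#
    vanish i = R.trans
      (R.*-congˡ (^-vanish a₀≈0 k (m ∸ toℕ i) (ℕ.≤-<-trans (ℕ.m∸n≤m m (toℕ i)) m<k)))
      (R.zeroʳ _)
    tail≈0 : (a ∘ suc *ₛ a ^ k) m ≈ 0#
    tail≈0 = R.trans (sum-cong-≋ {suc m} vanish) (sum-replicate-zero (suc m))

  open Algebra.Properties.Semiring.Mult (CommutativeRing.semiring commutativeRing)
    using () renaming (_×_ to _·_)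

  ·-vanish : ∀ k {a} → a 0 ≈ 0# → (k · a) 0 ≈ 0#
  ·-vanish zero    a₀≈0 = R.refl
  ·-vanish (suc k) a₀≈0 = R.trans (R.+-cong a₀≈0 (·-vanish k a₀≈0)) (R.+-identityʳ 0#)

  -ₛ-vanish : ∀ {a} → a 0 ≈ 0# → (-ₛ a) 0 ≈ 0#
  -ₛ-vanish a₀≈0 = R.trans (R.-‿cong a₀≈0) -0#≈0#
    where open Algebra.Properties.Ring R.ring using (-0#≈0#)

-- exp(a) = Σ_{k ≥ 0} aᵏ / k!  over a commutative ℚ-algebra
module Exponential
  (R : CommutativeRing c ℓ)
  (ι : ℚ → CommutativeRing.Carrier R)
  (ι-homo : RingMorphisms.IsRingHomomorphism ℚ.+-*-rawRing (CommutativeRing.rawRing R) ι)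
  where

  open CommutativeRing R using (_≈_; _*_; 0#)
  open PowerSeries R
  open Algebra.Properties.Semiring.Sum (CommutativeRing.semiring R)
  open Algebra.Properties.Semiring.Exp (CommutativeRing.semiring commutativeRing)

  -- For a series without constant term, the powers aᵏ with k > m do not
  -- contribute to the coefficient of uᵐ (^-vanish), so that coefficient of
  -- the infinite sum is the finite sum below.
  exp : (a : Series) → a 0 ≈ 0# → Series
  exp a _ m = ∑[ k ≤ m ] (ι (ℚ._/_ ℤ.1ℤ (toℕ k !) {{toℕ k ℕ.!≢0}}) * (a ^ toℕ k) m)

-- Polynomials D[x]: finitely supported coefficient sequences
module Polynomials (D : IntegralDomain c ℓ) where

  private module D = IntegralDomain D
  open D using (Carrier; _≈_; _+_; _*_; -_; 0#; 1#)
  private module S = PowerSeries D.commutativeRing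
  private module SR = CommutativeRing S.commutativeRing
  open Algebra.Properties.Semiring.Sum D.semiring

  record Poly : Set (c ⊔ ℓ) where
    constructor poly
    field
      coeff  : ℕ → Carrier
      bound  : ℕ
      vanish : ∀ n → bound ≤ n → coeff n ≈ 0#
  open Poly public

  infix 4 _≈ₚ_
  _≈ₚ_ : Poly → Poly → Set ℓ
  p ≈ₚ q = coeff p S.≈ₛ coeff q

  infixl 6 _+ₚ_
  infixl 7 _*ₚ_

  _+ₚ_ : Poly → Poly → Poly
  p +ₚ q = poly (coeff p S.+ₛ coeff q) (bound p ℕ.⊔ bound q) λ n b≤n →
    D.trans (D.+-cong (vanish p n (ℕ.m⊔n≤o⇒m≤o _ _ b≤n)) (vanish q n (ℕ.m⊔n≤o⇒n≤o (bound p) _ b≤n)))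
            (D.+-identityʳ 0#)

  _*ₚ_ : Poly → Poly → Poly
  p *ₚ q = poly (coeff p S.*ₛ coeff q) (bound p ℕ.+ bound q) λ n b≤n →
    D.trans (sum-cong-≋ {suc n} (λ i → term n (toℕ i) b≤n)) (sum-replicate-zero (suc n))
    where
    term : ∀ n i → bound p ℕ.+ bound q ≤ n → coeff p i * coeff q (n ∸ i) ≈ 0#
    term n i b≤n with ℕ.≤-total (bound p) i
    ... | inj₁ bp≤i = D.trans (D.*-congʳ (vanish p i bp≤i)) (D.zeroˡ _)
    ... | inj₂ i≤bp = D.trans (D.*-congˡ (vanish q (n ∸ i) bq≤n∸i)) (D.zeroʳ _)
      where
      bq≤n∸i : bound q ≤ n ∸ i
      bq≤n∸i = ℕ.m+n≤o⇒m≤o∸n (bound q) (ℕ.≤-trans (ℕ.+-monoʳ-≤ (bound q) i≤bp)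
                 (ℕ.≤-trans (ℕ.≤-reflexive (ℕ.+-comm (bound q) (bound p))) b≤n))

  -ₚ_ : Poly → Poly
  -ₚ p = poly (S.-ₛ coeff p) (bound p) λ n b≤n → D.trans (D.-‿cong (vanish p n b≤n)) -0≈0
    where open Algebra.Properties.Ring D.ring renaming (-0#≈0# to -0≈0)

  constant : Carrier → Poly
  constant x = poly (S.constant x) 1 λ { (suc n) _ → D.refl }

  0ₚ 1ₚ X : Poly
  0ₚ = poly S.0ₛ 0 λ _ _ → D.refl
  1ₚ = constant 1#
  X  = poly (λ { 1 → 1# ; _ → 0# }) 2 λ { (suc (suc n)) _ → D.refl ; 1 (s≤s ()) }

  commutativeRing : CommutativeRing (c ⊔ ℓ) ℓ
  commutativeRing = record
    { Carrier = Poly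
    ; _≈_ = _≈ₚ_
    ; _+_ = _+ₚ_
    ; _*_ = _*ₚ_
    ; -_  = -ₚ_
    ; 0#  = 0ₚ
    ; 1#  = 1ₚ
    ; isCommutativeRing = record
      { isRing = record
        { +-isAbelianGroup = record
          { isGroup = record
            { isMonoid = record
              { isSemigroup = record
                { isMagma = record
                  { isEquivalence = record
                    { refl  = λ n → D.refl
                    ; sym   = λ p n → D.sym (p n)
                    ; trans = λ p q n → D.trans (p n) (q n)
                    }
                  ; ∙-cong = λ p q n → D.+-cong (p n) (q n)
                  }
                ; assoc = λ p q r → SR.+-assoc (coeff p) (coeff q) (coeff r)
                }
              ; identity = (λ p → SR.+-identityˡ (coeff p)) , (λ p → SR.+-identityʳ (coeff p))
              }
            ; inverse = (λ p → SR.-‿inverseˡ (coeff p)) , (λ p → SR.-‿inverseʳ (coeff p))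
            ; ⁻¹-cong = λ p n → D.-‿cong (p n)
            }
          ; comm = λ p q → SR.+-comm (coeff p) (coeff q)
          }
        ; *-cong = S.*ₛ-cong
        ; *-assoc = λ p q r → SR.*-assoc (coeff p) (coeff q) (coeff r)
        ; *-identity = (λ p → SR.*-identityˡ (coeff p)) , (λ p → SR.*-identityʳ (coeff p))
        ; distrib = (λ p q r → SR.distribˡ (coeff p) (coeff q) (coeff r))
                  , (λ p q r → SR.distribʳ (coeff p) (coeff q) (coeff r))
        }
      ; *-comm = λ p q → SR.*-comm (coeff p) (coeff q)
      }
    }

  private
    _≟ₚ_ : Decidable _≈ₚ_
    p ≟ₚ q = map′ everywhere (λ p≈q {n} _ → p≈q n)
                  (ℕ.allUpTo? (λ n → coeff p n D.≟ coeff q n) (bound p ℕ.⊔ bound q))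
      where
      everywhere : (∀ {n} → n < bound p ℕ.⊔ bound q → coeff p n ≈ coeff q n) → p ≈ₚ q
      everywhere below n with n ℕ.<? (bound p ℕ.⊔ bound q)
      ... | yes n<b = below n<b
      ... | no  n≮b = D.trans (vanish p n (ℕ.m⊔n≤o⇒m≤o _ _ (ℕ.≮⇒≥ n≮b)))
                              (D.sym (vanish q n (ℕ.m⊔n≤o⇒n≤o (bound p) _ (ℕ.≮⇒≥ n≮b))))

    HasDegree : (ℕ → Carrier) → ℕ → Set ℓ
    HasDegree a d = ¬ (a d ≈ 0#) × (∀ n → d < n → a n ≈ 0#)

    degree : ∀ a N → (∀ n → N ≤ n → a n ≈ 0#) → (a S.≈ₛ S.0ₛ) ⊎ ∃ (HasDegree a)
    degree a zero    van = inj₁ λ n → van n z≤n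
    degree a (suc N) van with a N D.≟ 0#
    ... | no  aN≉0 = inj₂ (N , aN≉0 , van)
    ... | yes aN≈0 = degree a N λ n N≤n → case ℕ.m≤n⇒m<n∨m≡n N≤n of λ
      { (inj₁ N<n)    → van n N<n
      ; (inj₂ ≡.refl) → aN≈0
      }

    leading-* : ∀ a b d e → (∀ n → d < n → a n ≈ 0#) → (∀ n → e < n → b n ≈ 0#) →
                (a S.*ₛ b) (d ℕ.+ e) ≈ a d * b e
    leading-* a b zero zero a> b> = D.+-identityʳ _
    leading-* a b zero (suc e) a> b> =
      D.trans (D.+-congˡ (S.*ₛ-zeroˡ b (λ n → a> (suc n) (s≤s z≤n)) e)) (D.+-identityʳ _)
    leading-* a b (suc d) e a> b> = D.trans
      (D.+-cong (D.trans (D.*-congˡ (b> (suc (d ℕ.+ e)) (s≤s (ℕ.m≤n+m e d)))) (D.zeroʳ _))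
                (leading-* (a ∘ suc) b d e (λ n d<n → a> (suc n) (s≤s d<n)) b>))
      (D.+-identityˡ _)

    *ₚ-nonzero : ∀ {p q} → ¬ (p ≈ₚ 0ₚ) → ¬ (q ≈ₚ 0ₚ) → ¬ (p *ₚ q ≈ₚ 0ₚ)
    *ₚ-nonzero {p} {q} p≉0 q≉0 pq≈0
      with degree (coeff p) (bound p) (vanish p) | degree (coeff q) (bound q) (vanish q)
    ... | inj₁ p≈0 | _        = p≉0 p≈0
    ... | _        | inj₁ q≈0 = q≉0 q≈0
    ... | inj₂ (d , pd≉0 , p>) | inj₂ (e , qe≉0 , q>) =
      D.*-nonzero pd≉0 qe≉0
        (D.trans (D.sym (leading-* (coeff p) (coeff q) d e p> q>)) (pq≈0 (d ℕ.+ e)))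

  integralDomain : IntegralDomain (c ⊔ ℓ) ℓ
  integralDomain = record
    { commutativeRing = commutativeRing
    ; _≟_ = _≟ₚ_
    ; 1≉0 = λ 1≈0 → D.1≉0 (1≈0 0)
    ; *-nonzero = λ {p} {q} → *ₚ-nonzero {p} {q}
    }

  open RingMorphisms D.rawRing (CommutativeRing.rawRing commutativeRing)

  constant-homo : IsRingHomomorphism constant
  constant-homo = record
    { isSemiringHomomorphism = record
      { isNearSemiringHomomorphism = record
        { +-isMonoidHomomorphism = record
          { isMagmaHomomorphism = record
            { isRelHomomorphism = record
              { cong = λ { x≈y zero → x≈y ; x≈y (suc n) → D.refl } }
            ; homo = λ { x y zero → D.refl ; x y (suc n) → D.sym (D.+-identityʳ 0#) }
            }
          ; ε-homo = λ { zero → D.refl ; (suc n) → D.refl }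
          }
        ; *-homo = λ { x y zero    → D.sym (S.constant-*ₛ x (S.constant y) 0)
                     ; x y (suc n) → D.sym (D.trans (S.constant-*ₛ x (S.constant y) (suc n)) (D.zeroʳ x)) }
        }
      ; 1#-homo = λ n → D.refl
      }
    ; -‿homo = λ { x zero → D.refl ; x (suc n) → D.sym -0#≈0# }
    }
    where open Algebra.Properties.Ring D.ring using (-0#≈0#)

  private
    module P = CommutativeRing commutativeRing
    module PE = Algebra.Properties.Semiring.Exp P.semiring
    module DE = Algebra.Properties.Semiring.Exp D.semiring

  1-Xⁿ≉0 : ∀ n .{{_ : NonZero n}} → ¬ (1ₚ P.- X PE.^ n ≈ₚ 0ₚ)
  1-Xⁿ≉0 (suc k) 1-Xⁿ≈0 = D.1≉0 (begin
    1#                                          ≈⟨ D.+-identityʳ 1# ⟨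
    1# + 0#                                     ≈⟨ D.+-congˡ -0#≈0# ⟨
    1# + - 0#                                   ≈⟨ D.+-congˡ (D.-‿cong (D.zeroˡ _)) ⟨
    1# + - (0# * coeff (X PE.^ k) 0)            ≈⟨ D.+-congˡ (D.-‿cong (D.+-identityʳ _)) ⟨
    1# + - (0# * coeff (X PE.^ k) 0 + 0#)       ≈⟨ 1-Xⁿ≈0 0 ⟩
    0#                                          ∎)
    where
    open SetoidReasoning D.setoid
    open Algebra.Properties.Ring D.ring using (-0#≈0#)

  constant-^ : ∀ x n → coeff (constant x PE.^ n) 0 ≈ x DE.^ n
  constant-^ x zero    = D.refl
  constant-^ x (suc n) = D.trans (D.+-identityʳ _) (D.*-congˡ (constant-^ x n))

  1-constantⁿ≉0 : ∀ x n → ¬ (1# D.- x DE.^ n ≈ 0#) → ¬ (1ₚ P.- constant x PE.^ n ≈ₚ 0ₚ)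
  1-constantⁿ≉0 x n 1-xⁿ≉0 1-cⁿ≈0 =
    1-xⁿ≉0 (D.trans (D.+-congˡ (D.-‿cong (D.sym (constant-^ x n)))) (1-cⁿ≈0 0))

module Fractions (D : IntegralDomain c ℓ) where

  private module D = IntegralDomain D
  open D using (Carrier; _≈_; _+_; _*_; -_; 0#; 1#)
  open Algebra.Properties.Ring D.ring using (-‿distribˡ-*)
  open Solver D.commutativeSemiring using (solve; _:=_; _:+_; _:*_; con)
  open SetoidReasoning D.setoid

  -- Without eta, arithmetic on fractions does not unfold on neutral terms; with
  -- it, type checking equations between concrete fractions blows up.
  record Fraction : Set (c ⊔ ℓ) where
    no-eta-equality
    pattern
    constructor fraction
    field
      num   : Carrier
      den   : Carrier
      den≉0 : ¬ (den ≈ 0#)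
  open Fraction public

  infix  4 _≈ᶠ_
  infixl 6 _+ᶠ_
  infixl 7 _*ᶠ_

  record _≈ᶠ_ (x y : Fraction) : Set ℓ where
    constructor cross
    field
      uncross : num x * den y ≈ num y * den x
  open _≈ᶠ_ public

  _+ᶠ_ _*ᶠ_ : Fraction → Fraction → Fraction
  fraction a b b≉0 +ᶠ fraction c d d≉0 = fraction (a * d + c * b) (b * d) (D.*-nonzero b≉0 d≉0)
  fraction a b b≉0 *ᶠ fraction c d d≉0 = fraction (a * c) (b * d) (D.*-nonzero b≉0 d≉0)

  -ᶠ_ : Fraction → Fraction
  -ᶠ fraction a b b≉0 = fraction (- a) b b≉0

  embed : Carrier → Fraction
  embed x = fraction x 1# D.1≉0

  0ᶠ 1ᶠ : Fraction
  0ᶠ = embed 0#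
  1ᶠ = embed 1#

  private
    ≈ᶠ-trans : ∀ {x y z} → x ≈ᶠ y → y ≈ᶠ z → x ≈ᶠ z
    ≈ᶠ-trans {fraction a b _} {fraction c d d≉0} {fraction e f _} (cross ad≈cb) (cross cf≈ed) =
      cross (D.*-cancelʳ d≉0 (begin
        a * f * d  ≈⟨ solve 3 (λ a f d → a :* f :* d := a :* d :* f) D.refl a f d ⟩
        a * d * f  ≈⟨ D.*-congʳ ad≈cb ⟩
        c * b * f  ≈⟨ solve 3 (λ c b f → c :* b :* f := c :* f :* b) D.refl c b f ⟩
        c * f * b  ≈⟨ D.*-congʳ cf≈ed ⟩
        e * d * b  ≈⟨ solve 3 (λ e d b → e :* d :* b := e :* b :* d) D.refl e d b ⟩
        e * b * d  ∎))

    +ᶠ-cong : ∀ {x x′ y y′} → x ≈ᶠ x′ → y ≈ᶠ y′ → x +ᶠ y ≈ᶠ x′ +ᶠ y′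
    +ᶠ-cong {fraction a b _} {fraction a′ b′ _} {fraction c d _} {fraction c′ d′ _} (cross p) (cross q) = cross (begin
      (a * d + c * b) * (b′ * d′)
        ≈⟨ solve 6 (λ a b c d b′ d′ → (a :* d :+ c :* b) :* (b′ :* d′)
             := (a :* b′) :* (d :* d′) :+ (c :* d′) :* (b :* b′)) D.refl a b c d b′ d′ ⟩
      (a * b′) * (d * d′) + (c * d′) * (b * b′)    ≈⟨ D.+-cong (D.*-congʳ p) (D.*-congʳ q) ⟩
      (a′ * b) * (d * d′) + (c′ * d) * (b * b′)
        ≈⟨ solve 6 (λ a′ b c′ d b′ d′ → (a′ :* b) :* (d :* d′) :+ (c′ :* d) :* (b :* b′)
             := (a′ :* d′ :+ c′ :* b′) :* (b :* d)) D.refl a′ b c′ d b′ d′ ⟩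
      (a′ * d′ + c′ * b′) * (b * d) ∎)

    *ᶠ-cong : ∀ {x x′ y y′} → x ≈ᶠ x′ → y ≈ᶠ y′ → x *ᶠ y ≈ᶠ x′ *ᶠ y′
    *ᶠ-cong {fraction a b _} {fraction a′ b′ _} {fraction c d _} {fraction c′ d′ _} (cross p) (cross q) = cross (begin
      (a * c) * (b′ * d′)
        ≈⟨ solve 4 (λ a c b′ d′ → (a :* c) :* (b′ :* d′) := (a :* b′) :* (c :* d′)) D.refl a c b′ d′ ⟩
      (a * b′) * (c * d′)  ≈⟨ D.*-cong p q ⟩
      (a′ * b) * (c′ * d)
        ≈⟨ solve 4 (λ a′ b c′ d → (a′ :* b) :* (c′ :* d) := (a′ :* c′) :* (b :* d)) D.refl a′ b c′ d ⟩
      (a′ * c′) * (b * d) ∎)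

    -ᶠ-cong : ∀ {x y} → x ≈ᶠ y → -ᶠ x ≈ᶠ -ᶠ y
    -ᶠ-cong {fraction a b _} {fraction c d _} (cross p) = cross (begin
      - a * d    ≈⟨ -‿distribˡ-* a d ⟨
      - (a * d)  ≈⟨ D.-‿cong p ⟩
      - (c * b)  ≈⟨ -‿distribˡ-* c b ⟩
      - c * b    ∎)

    +ᶠ-assoc : ∀ x y z → (x +ᶠ y) +ᶠ z ≈ᶠ x +ᶠ (y +ᶠ z)
    +ᶠ-assoc (fraction a b _) (fraction c d _) (fraction e f _) = cross
      (solve 6 (λ a b c d e f →
        ((a :* d :+ c :* b) :* f :+ e :* (b :* d)) :* (b :* (d :* f))
        := (a :* (d :* f) :+ (c :* f :+ e :* d) :* b) :* ((b :* d) :* f)) D.refl a b c d e f)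

    +ᶠ-comm : ∀ x y → x +ᶠ y ≈ᶠ y +ᶠ x
    +ᶠ-comm (fraction a b _) (fraction c d _) = cross
      (solve 4 (λ a b c d → (a :* d :+ c :* b) :* (d :* b) := (c :* b :+ a :* d) :* (b :* d)) D.refl a b c d)

    +ᶠ-identityˡ : ∀ x → 0ᶠ +ᶠ x ≈ᶠ x
    +ᶠ-identityˡ (fraction a b _) = cross (begin
      (0# * b + a * 1#) * b  ≈⟨ D.*-congʳ (D.+-congʳ (D.zeroˡ b)) ⟩
      (0# + a * 1#) * b      ≈⟨ D.*-congʳ (D.+-identityˡ _) ⟩
      a * 1# * b             ≈⟨ D.*-assoc a 1# b ⟩
      a * (1# * b)           ∎)

    -ᶠ-inverseˡ : ∀ x → (-ᶠ x) +ᶠ x ≈ᶠ 0ᶠ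
    -ᶠ-inverseˡ (fraction a b _) = cross (begin
      (- a * b + a * b) * 1#  ≈⟨ D.*-congʳ (D.distribʳ b (- a) a) ⟨
      (- a + a) * b * 1#      ≈⟨ D.*-congʳ (D.*-congʳ (D.-‿inverseˡ a)) ⟩
      0# * b * 1#             ≈⟨ D.*-congʳ (D.zeroˡ b) ⟩
      0# * 1#                 ≈⟨ D.zeroˡ 1# ⟩
      0#                      ≈⟨ D.zeroˡ (b * b) ⟨
      0# * (b * b)            ∎)

    *ᶠ-assoc : ∀ x y z → (x *ᶠ y) *ᶠ z ≈ᶠ x *ᶠ (y *ᶠ z)
    *ᶠ-assoc (fraction a b _) (fraction c d _) (fraction e f _) = cross
      (solve 6 (λ a b c d e f → ((a :* c) :* e) :* (b :* (d :* f))
        := (a :* (c :* e)) :* ((b :* d) :* f)) D.refl a b c d e f)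

    *ᶠ-comm : ∀ x y → x *ᶠ y ≈ᶠ y *ᶠ x
    *ᶠ-comm (fraction a b _) (fraction c d _) = cross
      (solve 4 (λ a b c d → (a :* c) :* (d :* b) := (c :* a) :* (b :* d)) D.refl a b c d)

    *ᶠ-identityˡ : ∀ x → 1ᶠ *ᶠ x ≈ᶠ x
    *ᶠ-identityˡ (fraction a b _) = cross (begin
      1# * a * b    ≈⟨ D.*-congʳ (D.*-comm 1# a) ⟩
      a * 1# * b    ≈⟨ D.*-assoc a 1# b ⟩
      a * (1# * b)  ∎)

    *ᶠ-distribʳ : ∀ z x y → (x +ᶠ y) *ᶠ z ≈ᶠ x *ᶠ z +ᶠ y *ᶠ z
    *ᶠ-distribʳ (fraction e f _) (fraction a b _) (fraction c d _) = cross
      (solve 6 (λ a b c d e f →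
        ((a :* d :+ c :* b) :* e) :* ((b :* f) :* (d :* f))
        := ((a :* e) :* (d :* f) :+ (c :* e) :* (b :* f)) :* ((b :* d) :* f)) D.refl a b c d e f)

  commutativeRing : CommutativeRing (c ⊔ ℓ) ℓ
  commutativeRing = record
    { Carrier = Fraction
    ; _≈_ = _≈ᶠ_
    ; _+_ = _+ᶠ_
    ; _*_ = _*ᶠ_
    ; -_  = -ᶠ_
    ; 0#  = 0ᶠ
    ; 1#  = 1ᶠ
    ; isCommutativeRing = record
      { isRing = record
        { +-isAbelianGroup = record
          { isGroup = record
            { isMonoid = record
              { isSemigroup = record
                { isMagma = record
                  { isEquivalence = record
                    { refl  = cross D.refl
                    ; sym   = λ p → cross (D.sym (uncross p))
                    ; trans = ≈ᶠ-trans
                    }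
                  ; ∙-cong = +ᶠ-cong
                  }
                ; assoc = +ᶠ-assoc
                }
              ; identity = +ᶠ-identityˡ , λ x → ≈ᶠ-trans (+ᶠ-comm x 0ᶠ) (+ᶠ-identityˡ x)
              }
            ; inverse = -ᶠ-inverseˡ , λ x → ≈ᶠ-trans (+ᶠ-comm x (-ᶠ x)) (-ᶠ-inverseˡ x)
            ; ⁻¹-cong = -ᶠ-cong
            }
          ; comm = +ᶠ-comm
          }
        ; *-cong = *ᶠ-cong
        ; *-assoc = *ᶠ-assoc
        ; *-identity = *ᶠ-identityˡ , λ x → ≈ᶠ-trans (*ᶠ-comm x 1ᶠ) (*ᶠ-identityˡ x)
        ; distrib = (λ z x y → ≈ᶠ-trans (*ᶠ-comm z (x +ᶠ y))
                      (≈ᶠ-trans (*ᶠ-distribʳ z x y) (+ᶠ-cong (*ᶠ-comm x z) (*ᶠ-comm y z))))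
                  , *ᶠ-distribʳ
        }
      ; *-comm = *ᶠ-comm
      }
    }

  open RingMorphisms D.rawRing (CommutativeRing.rawRing commutativeRing)

  embed-homo : IsRingHomomorphism embed
  embed-homo = record
    { isSemiringHomomorphism = record
      { isNearSemiringHomomorphism = record
        { +-isMonoidHomomorphism = record
          { isMagmaHomomorphism = record
            { isRelHomomorphism = record { cong = λ x≈y → cross (D.*-congʳ x≈y) }
            ; homo = λ x y → cross (D.*-cong
                (D.+-cong (D.sym (D.*-identityʳ x)) (D.sym (D.*-identityʳ y))) (D.*-identityˡ 1#))
            }
          ; ε-homo = cross D.refl
          }
        ; *-homo = λ x y → cross (D.*-congˡ (D.*-identityˡ 1#))
        }
      ; 1#-homo = cross D.refl
      }
    ; -‿homo = λ x → cross D.refl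
    }

ℚ-integralDomain : IntegralDomain 0ℓ 0ℓ
ℚ-integralDomain = record
  { commutativeRing = ℚ.+-*-commutativeRing
  ; _≟_ = ℚ._≟_
  ; 1≉0 = ℚ.1≢0
  ; *-nonzero = *-nonzero
  }
  where
  *-nonzero : ∀ {x y} → ¬ (x ≡ 0ℚ) → ¬ (y ≡ 0ℚ) → ¬ (x ℚ.* y ≡ 0ℚ)
  *-nonzero {x} {y} x≢0 y≢0 xy≡0 = y≢0 (begin
    y                   ≡⟨ ℚ.*-identityˡ y ⟨
    1ℚ ℚ.* y            ≡⟨ ≡.cong (ℚ._* y) (ℚ.*-inverseˡ x) ⟨
    ℚ.1/ x ℚ.* x ℚ.* y  ≡⟨ ℚ.*-assoc (ℚ.1/ x) x y ⟩
    ℚ.1/ x ℚ.* (x ℚ.* y) ≡⟨ ≡.cong (ℚ.1/ x ℚ.*_) xy≡0 ⟩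
    ℚ.1/ x ℚ.* 0ℚ       ≡⟨ ℚ.*-zeroʳ (ℚ.1/ x) ⟩
    0ℚ                  ∎)
    where
    open ≡.≡-Reasoning
    instance _ = ℚ.≢-nonZero x≢0

-- ℚ[t,s] is realised as ℚ[t][s], and ℚ⟨t,s⟩ is its field of fractions ℚ(t,s).
module ℚ[t] = Polynomials ℚ-integralDomain
module ℚ[t,s] = Polynomials ℚ[t].integralDomain
module ℚ⟨t,s⟩ = Fractions ℚ[t,s].integralDomain

tₚ sₚ : ℚ[t,s].Poly
tₚ = ℚ[t,s].constant ℚ[t].X
sₚ = ℚ[t,s].X

ι : ℚ → ℚ⟨t,s⟩.Fraction
ι = ℚ⟨t,s⟩.embed ∘ ℚ[t,s].constant ∘ ℚ[t].constant

ι-homo : RingMorphisms.IsRingHomomorphism ℚ.+-*-rawRing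
           (CommutativeRing.rawRing ℚ⟨t,s⟩.commutativeRing) ι
ι-homo = Composition.isRingHomomorphism K.trans
  (Composition.isRingHomomorphism (λ {x} {y} {z} → P.trans {x} {y} {z})
    ℚ[t].constant-homo ℚ[t,s].constant-homo)
  ℚ⟨t,s⟩.embed-homo
  where
  module K = CommutativeRing ℚ⟨t,s⟩.commutativeRing
  module P = CommutativeRing ℚ[t,s].commutativeRing

module _ where
  open CommutativeRing ℚ[t,s].commutativeRing using (_≈_; 0#; 1#; _-_; semiring)
  open Algebra.Properties.Semiring.Exp semiring using (_^_)

  1-tⁿ≉0 : ∀ n .{{_ : NonZero n}} → ¬ (1# - tₚ ^ n ≈ 0#)
  1-tⁿ≉0 n = ℚ[t,s].1-constantⁿ≉0 ℚ[t].X n (ℚ[t].1-Xⁿ≉0 n)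

  ratio : ∀ n .{{_ : NonZero n}} → ℚ⟨t,s⟩.Fraction
  ratio n = ℚ⟨t,s⟩.fraction (1# - sₚ ^ n) (1# - tₚ ^ n) (1-tⁿ≉0 n)

isOdd : ℕ → Bool
isOdd n = not (does (2 ∣? n))

module 𝕂 = CommutativeRing ℚ⟨t,s⟩.commutativeRing
module 𝕂[[u]] = PowerSeries ℚ⟨t,s⟩.commutativeRing

-- Σ_{n ≥ 1, n odd} (1 - sⁿ)/(1 - tⁿ) · uⁿ/n
oddSeries : 𝕂[[u]].Series
oddSeries zero      = 𝕂.0#
oddSeries n@(suc _) = if isOdd n then ratio n 𝕂.* ι (ℤ.1ℤ ℚ./ n) else 𝕂.0#

module _ where
  open CommutativeRing 𝕂[[u]].commutativeRing using (-_; semiring)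
  open Algebra.Properties.Semiring.Mult semiring using () renaming (_×_ to _·_)

  exponent : 𝕂[[u]].Series
  exponent = - (2 · oddSeries)

  exponent₀≈0 : exponent 0 𝕂.≈ 𝕂.0#
  exponent₀≈0 = 𝕂[[u]].-ₛ-vanish {2 · oddSeries} (𝕂[[u]].·-vanish 2 {oddSeries} 𝕂.refl)

F : 𝕂[[u]].Series
F = Exponential.exp ℚ⟨t,s⟩.commutativeRing ι ι-homo exponent exponent₀≈0

f : ℕ → 𝕂.Carrier
f m = F m

{-# OPTIONS --safe #-}
module Submission where

-- The recurrence is the coefficient form of the differential equation
-- u F' = (u a') F satisfied by F = exp a, where a is the exponent.
--
-- The operator θ = u d/du multiplies the coefficient of uⁿ by n, and it is a
-- derivation of R[[u]] (θ-isDerivation).  For any derivation D of a commutative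
-- ring and constants γ₀, γ₁, ... of D with (k + 1) γₖ₊₁ = γₖ, the partial sums
-- Eₙ = Σ_{k < n} γₖ xᵏ satisfy D Eₙ₊₁ = D x · Eₙ (D-partialExp).  Taking D = θ
-- and γₖ = 1/k!, the coefficient of uᵐ in exp a is that of every Eₙ with m < n,
-- because a has no constant term (partialExp-coeff).  Comparing coefficients
-- in θ Eₙ₊₁ = θ a · Eₙ gives
--   m [uᵐ] exp a = Σ_{1 ≤ j ≤ m} j aⱼ [u^(m-j)] exp a      (exp-recurrence).
-- For the exponent of F, j aⱼ is -2 (1 - sʲ)/(1 - tʲ) when j is odd and 0
-- otherwise (weight-exponent, weighted-recurrence), since j cancels the denominator of uʲ/j.

open import Defs
open import Level using (Level; _⊔_)
open import Algebra.Bundles using (CommutativeRing)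
open import Algebra.Morphism.Structures using (module RingMorphisms)
import Algebra.Properties.CommutativeMonoid.Mult
import Algebra.Properties.CommutativeSemigroup
import Algebra.Properties.Group
import Algebra.Properties.Ring
import Algebra.Properties.Semiring.Exp
import Algebra.Properties.Semiring.Mult
import Algebra.Properties.Semiring.Sum
open import Data.Bool.Base using (Bool; true; false; if_then_else_)
open import Data.Fin.Base using (toℕ)
open import Data.Fin.Properties using (toℕ≤pred[n])
open import Data.Integer.Base as ℤ using (+_; 1ℤ)
import Data.Integer.Properties as ℤ
open import Data.Integer.Solver using (module +-*-Solver)
open import Data.Nat.Base as ℕ using (ℕ; zero; suc; _∸_; _≤_; _<_; s≤s; NonZero; _!)
import Data.Nat.Properties as ℕ
open import Data.Product.Base using (_×_; _,_)
open import Data.Rational.Base as ℚ using (ℚ; 1ℚ)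
import Data.Rational.Properties as ℚ
open import Data.Rational.Unnormalised.Base as ℚᵘ using (mkℚᵘ; *≡*)
import Data.Rational.Unnormalised.Properties as ℚᵘ
open import Data.Sum.Base using (_⊎_; inj₁; inj₂)
open import Data.Vec.Functional using (Vector)
open import Function.Base using (_∘_)
open import Relation.Binary.PropositionalEquality as ≡ using (_≡_)
import Relation.Binary.Reasoning.Setoid as SetoidReasoning

private
  variable
    c ℓ : Level

-- Derivations of commutative rings

module _ (R : CommutativeRing c ℓ) where
  open CommutativeRing R

  -- An additive map satisfying the Leibniz rule; linearity over a base ring is
  -- not part of the notion.
  record IsDerivation (D : Carrier → Carrier) : Set (c ⊔ ℓ) where
    field
      cong    : ∀ {x y} → x ≈ y → D x ≈ D y
      +-homo  : ∀ x y → D (x + y) ≈ D x + D y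
      leibniz : ∀ x y → D (x * y) ≈ D x * y + x * D y

module Derivation
  (R : CommutativeRing c ℓ) {D : CommutativeRing.Carrier R → CommutativeRing.Carrier R}
  (isDerivation : IsDerivation R D) where

  open CommutativeRing R
  open IsDerivation isDerivation renaming (cong to D-cong; +-homo to D-+; leibniz to D-*)
  open Algebra.Properties.CommutativeSemigroup *-commutativeSemigroup using (x∙yz≈y∙xz)
  open Algebra.Properties.Group +-group using (identityˡ-unique)
  open Algebra.Properties.Semiring.Exp semiring using (_^_)
  open Algebra.Properties.Semiring.Mult semiring
    using (×-congʳ; ×-comm-*; ×-assoc-*) renaming (_×_ to _·_)
  open SetoidReasoning setoid

  D-0 : D 0# ≈ 0#
  D-0 = identityˡ-unique (D 0#) (D 0#)
    (trans (sym (D-+ 0# 0#)) (D-cong (+-identityˡ 0#)))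

  D-1 : D 1# ≈ 0#
  D-1 = identityˡ-unique (D 1#) (D 1#) (begin
    D 1# + D 1#            ≈⟨ +-cong (*-identityʳ _) (*-identityˡ _) ⟨
    D 1# * 1# + 1# * D 1#  ≈⟨ D-* 1# 1# ⟨
    D (1# * 1#)            ≈⟨ D-cong (*-identityˡ 1#) ⟩
    D 1#                   ∎)

  D-constant-* : ∀ {k} x → D k ≈ 0# → D (k * x) ≈ k * D x
  D-constant-* {k} x Dk≈0 = begin
    D (k * x)          ≈⟨ D-* k x ⟩
    D k * x + k * D x  ≈⟨ +-congʳ (trans (*-congʳ Dk≈0) (zeroˡ x)) ⟩
    0# + k * D x       ≈⟨ +-identityˡ _ ⟩
    k * D x            ∎

  D-^ : ∀ x k → D (x ^ suc k) ≈ suc k · (D x * x ^ k)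
  D-^ x zero = begin
    D (x * 1#)             ≈⟨ D-* x 1# ⟩
    D x * 1# + x * D 1#    ≈⟨ +-congˡ (trans (*-congˡ D-1) (zeroʳ x)) ⟩
    D x * 1# + 0#          ∎
  D-^ x (suc k) = begin
    D (x * x ^ suc k)                                  ≈⟨ D-* x (x ^ suc k) ⟩
    D x * x ^ suc k + x * D (x ^ suc k)                ≈⟨ +-congˡ (*-congˡ (D-^ x k)) ⟩
    D x * x ^ suc k + x * (suc k · (D x * x ^ k))      ≈⟨ +-congˡ (×-comm-* (suc k) x _) ⟩
    D x * x ^ suc k + suc k · (x * (D x * x ^ k))      ≈⟨ +-congˡ (×-congʳ (suc k) (x∙yz≈y∙xz x (D x) (x ^ k))) ⟩
    D x * x ^ suc k + suc k · (D x * x ^ suc k)        ∎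

  -- The hypotheses on γ say that it behaves like k ↦ 1/k!, up to a common
  -- factor γ 0.
  module PartialExp
    (γ : ℕ → Carrier) (D-γ : ∀ k → D (γ k) ≈ 0#) (γ-suc : ∀ k → suc k · γ (suc k) ≈ γ k) where

    -- partialExp x n = Σ_{k < n} γₖ xᵏ
    partialExp : Carrier → ℕ → Carrier
    partialExp x zero    = 0#
    partialExp x (suc n) = partialExp x n + γ n * x ^ n

    D-term : ∀ x k → D (γ (suc k) * x ^ suc k) ≈ D x * (γ k * x ^ k)
    D-term x k = begin
      D (γ (suc k) * x ^ suc k)                ≈⟨ D-constant-* (x ^ suc k) (D-γ (suc k)) ⟩
      γ (suc k) * D (x ^ suc k)                ≈⟨ *-congˡ (D-^ x k) ⟩
      γ (suc k) * (suc k · (D x * x ^ k))      ≈⟨ ×-comm-* (suc k) (γ (suc k)) _ ⟩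
      suc k · (γ (suc k) * (D x * x ^ k))      ≈⟨ ×-assoc-* (suc k) (γ (suc k)) _ ⟨
      (suc k · γ (suc k)) * (D x * x ^ k)      ≈⟨ *-congʳ (γ-suc k) ⟩
      γ k * (D x * x ^ k)                      ≈⟨ x∙yz≈y∙xz (γ k) (D x) (x ^ k) ⟩
      D x * (γ k * x ^ k)                      ∎

    D-partialExp : ∀ x n → D (partialExp x (suc n)) ≈ D x * partialExp x n
    D-partialExp x zero = begin
      D (0# + γ 0 * 1#)      ≈⟨ D-+ 0# (γ 0 * 1#) ⟩
      D 0# + D (γ 0 * 1#)    ≈⟨ +-cong D-0 (D-constant-* 1# (D-γ 0)) ⟩
      0# + γ 0 * D 1#        ≈⟨ +-identityˡ _ ⟩
      γ 0 * D 1#             ≈⟨ *-congˡ D-1 ⟩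
      γ 0 * 0#               ≈⟨ zeroʳ (γ 0) ⟩
      0#                     ≈⟨ zeroʳ (D x) ⟨
      D x * 0#               ∎
    D-partialExp x (suc n) = begin
      D (partialExp x (suc n) + γ (suc n) * x ^ suc n)          ≈⟨ D-+ _ _ ⟩
      D (partialExp x (suc n)) + D (γ (suc n) * x ^ suc n)      ≈⟨ +-cong (D-partialExp x n) (D-term x n) ⟩
      D x * partialExp x n + D x * (γ n * x ^ n)                ≈⟨ distribˡ (D x) _ _ ⟨
      D x * partialExp x (suc n)                                ∎

-- The Euler operator on formal power series

module Euler (R : CommutativeRing c ℓ) where

  private module R = CommutativeRing R
  open R using (Carrier; _≈_; _+_; _*_; 0#; 1#)
  open PowerSeries R
  open Algebra.Properties.CommutativeMonoid.Mult R.+-commutativeMonoid using (×-distrib-+)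
  open Algebra.Properties.Semiring.Mult R.semiring
    using (×-congʳ; ×-congˡ; ×-homo-+; ×-comm-*; ×-assoc-*) renaming (_×_ to _·_)
  open Algebra.Properties.Semiring.Sum R.semiring
  open SetoidReasoning R.setoid

  ·≈·1* : ∀ n x → n · x ≈ (n · 1#) * x
  ·≈·1* n x = R.sym (R.trans (×-assoc-* n 1# x) (×-congʳ n (R.*-identityˡ x)))

  ·-zeroʳ : ∀ n → n · 0# ≈ 0#
  ·-zeroʳ n = R.trans (·≈·1* n 0#) (R.zeroʳ _)

  ·-distribˡ-sum : ∀ n {k} (v : Vector Carrier k) → n · sum v ≈ ∑[ i < k ] (n · v i)
  ·-distribˡ-sum n {k} v = begin
    n · sum v                      ≈⟨ ·≈·1* n (sum v) ⟩
    (n · 1#) * sum v               ≈⟨ *-distribˡ-sum (n · 1#) v ⟩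
    ∑[ i < k ] ((n · 1#) * v i)    ≈⟨ sum-cong-≋ (λ i → R.sym (·≈·1* n (v i))) ⟩
    ∑[ i < k ] (n · v i)           ∎

  -- θ = u d/du
  θ : Series → Series
  θ a n = n · a n

  θ-constant : ∀ x → θ (constant x) ≈ₛ 0ₛ
  θ-constant x zero    = R.refl
  θ-constant x (suc n) = ·-zeroʳ (suc n)

  -- Each term of the Cauchy product has n = i + (n - i), which splits the
  -- factor n between the two series.
  θ-leibniz : ∀ a b → θ (a *ₛ b) ≈ₛ θ a *ₛ b +ₛ a *ₛ θ b
  θ-leibniz a b n = begin
    n · (a *ₛ b) n
      ≈⟨ ·-distribˡ-sum n {suc n} (λ i → a (toℕ i) * b (n ∸ toℕ i)) ⟩
    ∑[ i ≤ n ] (n · (a (toℕ i) * b (n ∸ toℕ i)))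
      ≈⟨ sum-cong-≋ {suc n} (λ i → split (toℕ i) (toℕ≤pred[n] i)) ⟩
    ∑[ i ≤ n ] (θ a (toℕ i) * b (n ∸ toℕ i) + a (toℕ i) * θ b (n ∸ toℕ i))
      ≈⟨ ∑-distrib-+ {suc n} (λ i → θ a (toℕ i) * b (n ∸ toℕ i)) (λ i → a (toℕ i) * θ b (n ∸ toℕ i)) ⟩
    (θ a *ₛ b +ₛ a *ₛ θ b) n ∎
    where
    split : ∀ i → i ≤ n → n · (a i * b (n ∸ i)) ≈ θ a i * b (n ∸ i) + a i * θ b (n ∸ i)
    split i i≤n = begin
      n · (a i * b (n ∸ i))
        ≈⟨ ×-congˡ (ℕ.m+[n∸m]≡n i≤n) ⟨
      (i ℕ.+ (n ∸ i)) · (a i * b (n ∸ i))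
        ≈⟨ ×-homo-+ _ i (n ∸ i) ⟩
      i · (a i * b (n ∸ i)) + (n ∸ i) · (a i * b (n ∸ i))
        ≈⟨ R.+-cong (×-assoc-* i (a i) (b (n ∸ i))) (×-comm-* (n ∸ i) (a i) (b (n ∸ i))) ⟨
      θ a i * b (n ∸ i) + a i * θ b (n ∸ i) ∎

  θ-isDerivation : IsDerivation commutativeRing θ
  θ-isDerivation = record
    { cong    = λ a≈b n → ×-congʳ n (a≈b n)
    ; +-homo  = λ a b n → ×-distrib-+ (a n) (b n) n
    ; leibniz = θ-leibniz
    }

-- Unit fractions

module ℚMult = Algebra.Properties.Semiring.Mult
  (CommutativeRing.semiring ℚ.+-*-commutativeRing)

/-+-sameDenominator : ∀ p q d .{{_ : NonZero d}} → (p ℚ./ d) ℚ.+ (q ℚ./ d) ≡ (p ℤ.+ q) ℚ./ d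
/-+-sameDenominator p q (suc d) = ℚ.toℚᵘ-injective (begin
  ℚ.toℚᵘ ((p ℚ./ suc d) ℚ.+ (q ℚ./ suc d))
    ≈⟨ ℚ.toℚᵘ-homo-+ (p ℚ./ suc d) (q ℚ./ suc d) ⟩
  ℚ.toℚᵘ (p ℚ./ suc d) ℚᵘ.+ ℚ.toℚᵘ (q ℚ./ suc d)
    ≈⟨ ℚᵘ.+-cong (ℚ.toℚᵘ-fromℚᵘ (mkℚᵘ p d)) (ℚ.toℚᵘ-fromℚᵘ (mkℚᵘ q d)) ⟩
  mkℚᵘ p d ℚᵘ.+ mkℚᵘ q d
    ≈⟨ *≡* (solve 3 (λ x y z → (x :* z :+ y :* z) :* z := (x :+ y) :* (z :* z)) ≡.refl p q (+ suc d)) ⟩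
  mkℚᵘ (p ℤ.+ q) d
    ≈⟨ ℚ.toℚᵘ-fromℚᵘ (mkℚᵘ (p ℤ.+ q) d) ⟨
  ℚ.toℚᵘ ((p ℤ.+ q) ℚ./ suc d) ∎)
  where
  open SetoidReasoning ℚᵘ.≃-setoid
  open +-*-Solver

×-unitFraction : ∀ n d .{{_ : NonZero d}} → n ℚMult.× (1ℤ ℚ./ d) ≡ + n ℚ./ d
×-unitFraction zero    d = ≡.sym (ℚ.0/n≡0 d)
×-unitFraction (suc n) d =
  ≡.trans (≡.cong ((1ℤ ℚ./ d) ℚ.+_) (×-unitFraction n d)) (/-+-sameDenominator 1ℤ (+ n) d)

×-unitFraction-cancel : ∀ n d .{{_ : NonZero d}} .{{_ : NonZero (suc n ℕ.* d)}} →
                        suc n ℚMult.× (1ℤ ℚ./ (suc n ℕ.* d)) ≡ 1ℤ ℚ./ d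
×-unitFraction-cancel n d@(suc d-1) = ≡.trans (×-unitFraction (suc n) (suc n ℕ.* d))
  (ℚ.fromℚᵘ-cong {mkℚᵘ (+ suc n) (d-1 ℕ.+ n ℕ.* d)} {mkℚᵘ 1ℤ d-1}
    (*≡* (≡.sym (ℤ.*-identityˡ _))))

-- The recurrence for exponentials

module ExpRecurrence
  (R : CommutativeRing c ℓ)
  (ι : ℚ → CommutativeRing.Carrier R)
  (ι-homo : RingMorphisms.IsRingHomomorphism ℚ.+-*-rawRing (CommutativeRing.rawRing R) ι)
  where

  private module R = CommutativeRing R
  open R using (Carrier; _≈_; _+_; _*_; 0#; 1#)
  open RingMorphisms.IsRingHomomorphism ι-homo
    using (⟦⟧-cong; +-homo; 0#-homo; 1#-homo)
  open PowerSeries R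
  open Exponential R ι ι-homo
  open Euler R
  private module S = CommutativeRing commutativeRing
  open Derivation commutativeRing θ-isDerivation
  open Algebra.Properties.Semiring.Exp S.semiring using (_^_)
  private module SMult = Algebra.Properties.Semiring.Mult S.semiring
  open Algebra.Properties.Semiring.Mult R.semiring
    using (×-congʳ) renaming (_×_ to _·_)
  open Algebra.Properties.Semiring.Sum R.semiring
  open SetoidReasoning R.setoid

  ι-· : ∀ n q → ι (n ℚMult.× q) ≈ n · ι q
  ι-· zero    q = 0#-homo
  ι-· (suc n) q = R.trans (+-homo q (n ℚMult.× q)) (R.+-congˡ (ι-· n q))

  ι-unitFraction-cancel : ∀ n d .{{_ : NonZero d}} .{{_ : NonZero (suc n ℕ.* d)}} →
                          suc n · ι (1ℤ ℚ./ (suc n ℕ.* d)) ≈ ι (1ℤ ℚ./ d)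
  ι-unitFraction-cancel n d =
    R.trans (R.sym (ι-· (suc n) _)) (⟦⟧-cong (×-unitFraction-cancel n d))

  ι-inverse : ∀ n .{{_ : NonZero n}} → n · ι (1ℤ ℚ./ n) ≈ 1#
  ι-inverse (suc n) = begin
    suc n · ι (1ℤ ℚ./ suc n)
      ≈⟨ ×-congʳ (suc n) (⟦⟧-cong (ℚ./-cong {1ℤ} {suc n} ≡.refl (≡.sym (ℕ.*-identityʳ (suc n))))) ⟩
    suc n · ι (1ℤ ℚ./ (suc n ℕ.* 1))
      ≈⟨ ι-unitFraction-cancel n 1 ⟩
    ι 1ℚ
      ≈⟨ 1#-homo ⟩
    1# ∎

  -- 1/k! in R
  1/_! : ℕ → Carrier
  1/ k ! = ι (ℚ._/_ 1ℤ (k !) {{k ℕ.!≢0}})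

  1/suc! : ∀ k → suc k · 1/ suc k ! ≈ 1/ k !
  1/suc! k = ι-unitFraction-cancel k (k !) {{k ℕ.!≢0}} {{suc k ℕ.!≢0}}

  ·ₛ-constant : ∀ n x → n SMult.× constant x ≈ₛ constant (n · x)
  ·ₛ-constant zero    x zero    = R.refl
  ·ₛ-constant zero    x (suc m) = R.refl
  ·ₛ-constant (suc n) x zero    = R.+-congˡ (·ₛ-constant n x zero)
  ·ₛ-constant (suc n) x (suc m) =
    R.trans (R.+-identityˡ _) (·ₛ-constant n x (suc m))

  constant-cong : ∀ {x y} → x ≈ y → constant x ≈ₛ constant y
  constant-cong x≈y zero    = x≈y
  constant-cong x≈y (suc n) = R.refl

  open PartialExp (λ k → constant (1/ k !)) (λ k → θ-constant (1/ k !))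
    (λ k → S.trans {suc k SMult.× constant (1/ suc k !)} {constant (suc k · 1/ suc k !)}
             (·ₛ-constant (suc k) (1/ suc k !)) (constant-cong (1/suc! k)))

  sum-suc : ∀ n (g : ℕ → Carrier) → ∑[ k < suc n ] g (toℕ k) ≈ ∑[ k < n ] g (toℕ k) + g n
  sum-suc zero    g = R.+-comm (g 0) 0#
  sum-suc (suc n) g = R.trans (R.+-congˡ (sum-suc n (g ∘ suc))) (R.sym (R.+-assoc _ _ _))

  partialExp-sum : ∀ a n m → partialExp a n m ≈ ∑[ k < n ] (1/ toℕ k ! * (a ^ toℕ k) m)
  partialExp-sum a zero    m = R.refl
  partialExp-sum a (suc n) m = begin
    partialExp a n m + (constant (1/ n !) *ₛ a ^ n) m
      ≈⟨ R.+-cong (partialExp-sum a n m) (constant-*ₛ (1/ n !) (a ^ n) m) ⟩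
    ∑[ k < n ] (1/ toℕ k ! * (a ^ toℕ k) m) + 1/ n ! * (a ^ n) m
      ≈⟨ sum-suc n (λ k → 1/ k ! * (a ^ k) m) ⟨
    ∑[ k < suc n ] (1/ toℕ k ! * (a ^ toℕ k) m) ∎

  partialExp-coeff : ∀ a (a₀≈0 : a 0 ≈ 0#) n m → m < n → partialExp a n m ≈ exp a a₀≈0 m
  partialExp-coeff a a₀≈0 (suc n) m (s≤s m≤n) = split (ℕ.m≤n⇒m<n∨m≡n m≤n)
    where
    split : m < n ⊎ m ≡ n → partialExp a (suc n) m ≈ exp a a₀≈0 m
    split (inj₂ ≡.refl) = partialExp-sum a (suc n) n
    split (inj₁ m<n)    = begin
      partialExp a n m + (constant (1/ n !) *ₛ a ^ n) m
        ≈⟨ R.+-cong (partialExp-coeff a a₀≈0 n m m<n) (constant-*ₛ (1/ n !) (a ^ n) m) ⟩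
      exp a a₀≈0 m + 1/ n ! * (a ^ n) m
        ≈⟨ R.+-congˡ (R.*-congˡ (^-vanish a₀≈0 n m m<n)) ⟩
      exp a a₀≈0 m + 1/ n ! * 0#
        ≈⟨ R.+-congˡ (R.zeroʳ _) ⟩
      exp a a₀≈0 m + 0#
        ≈⟨ R.+-identityʳ _ ⟩
      exp a a₀≈0 m ∎

  exp-zero : ∀ a (a₀≈0 : a 0 ≈ 0#) → exp a a₀≈0 0 ≈ 1#
  exp-zero a a₀≈0 = begin
    ι 1ℚ * 1# + 0#  ≈⟨ R.+-identityʳ _ ⟩
    ι 1ℚ * 1#       ≈⟨ R.*-identityʳ _ ⟩
    ι 1ℚ            ≈⟨ 1#-homo ⟩
    1#              ∎

  exp-recurrence : ∀ a (a₀≈0 : a 0 ≈ 0#) n →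
    suc n · exp a a₀≈0 (suc n) ≈ ∑[ i ≤ n ] (θ a (suc (toℕ i)) * exp a a₀≈0 (n ∸ toℕ i))
  exp-recurrence a a₀≈0 n = begin
    suc n · exp a a₀≈0 (suc n)
      ≈⟨ ×-congʳ (suc n) (partialExp-coeff a a₀≈0 (suc (suc n)) (suc n) ℕ.≤-refl) ⟨
    θ (partialExp a (suc (suc n))) (suc n)
      ≈⟨ D-partialExp a (suc n) (suc n) ⟩
    -- θ a has no constant term, so the first term of the product drops out.
    0# * E (suc n) + (θ a ∘ suc *ₛ E) n
      ≈⟨ R.trans (R.+-congʳ (R.zeroˡ _)) (R.+-identityˡ _) ⟩
    ∑[ i ≤ n ] (θ a (suc (toℕ i)) * E (n ∸ toℕ i))
      ≈⟨ sum-cong-≋ {suc n} (λ i → R.*-congˡ {θ a (suc (toℕ i))}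
           (partialExp-coeff a a₀≈0 (suc n) (n ∸ toℕ i) (s≤s (ℕ.m∸n≤m n (toℕ i))))) ⟩
    ∑[ i ≤ n ] (θ a (suc (toℕ i)) * exp a a₀≈0 (n ∸ toℕ i)) ∎
    where
    E : Series
    E = partialExp a (suc n)

-- Exponents of the form -2 Σ wₙ uⁿ/n

module WeightedExponent
  (R : CommutativeRing c ℓ)
  (ι : ℚ → CommutativeRing.Carrier R)
  (ι-homo : RingMorphisms.IsRingHomomorphism ℚ.+-*-rawRing (CommutativeRing.rawRing R) ι)
  where

  private module R = CommutativeRing R
  open R using (Carrier; _≈_; _*_; -_; 0#; 1#)
  open PowerSeries R
  open Exponential R ι ι-homo
  open ExpRecurrence R ι ι-homo using (ι-inverse; exp-recurrence)
  private
    module S = CommutativeRing commutativeRing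
    module SMult = Algebra.Properties.Semiring.Mult S.semiring
  open Euler R using (·-zeroʳ; ·≈·1*)
  open Algebra.Properties.Ring R.ring using (-‿distribˡ-*)
  open Algebra.Properties.Semiring.Mult R.semiring
    using (×-comm-*; ×-congʳ) renaming (_×_ to _·_)
  open Algebra.Properties.Semiring.Sum R.semiring
  open SetoidReasoning R.setoid

  private
    -2# : Carrier
    -2# = - (2 · 1#)

    -2·≈-2#* : ∀ x → - (2 · x) ≈ -2# * x
    -2·≈-2#* x = R.trans (R.-‿cong (·≈·1* 2 x)) (-‿distribˡ-* (2 · 1#) x)

  weight-unitFraction : ∀ n .{{_ : NonZero n}} b x →
    n · (if b then x * ι (1ℤ ℚ./ n) else 0#) ≈ (if b then x else 0#)
  weight-unitFraction n false x = ·-zeroʳ n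
  weight-unitFraction n true  x = begin
    n · (x * ι (1ℤ ℚ./ n))  ≈⟨ ×-comm-* n x _ ⟨
    x * (n · ι (1ℤ ℚ./ n))  ≈⟨ R.*-congˡ (ι-inverse n) ⟩
    x * 1#                  ≈⟨ R.*-identityʳ x ⟩
    x                       ∎

  weight-exponent : ∀ n .{{_ : NonZero n}} b x →
    n · (- (2 · (if b then x * ι (1ℤ ℚ./ n) else 0#))) ≈ - (2 · (if b then x else 0#))
  weight-exponent n b x = begin
    n · (- (2 · y))                ≈⟨ ×-congʳ n (-2·≈-2#* y) ⟩
    n · (-2# * y)                  ≈⟨ ×-comm-* n -2# y ⟨
    -2# * (n · y)                  ≈⟨ R.*-congˡ (weight-unitFraction n b x) ⟩
    -2# * (if b then x else 0#)    ≈⟨ -2·≈-2#* _ ⟨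
    - (2 · (if b then x else 0#))  ∎
    where
    y : Carrier
    y = if b then x * ι (1ℤ ℚ./ n) else 0#

  if-* : ∀ b x y → (if b then x else 0#) * y ≈ (if b then x * y else 0#)
  if-* true  x y = R.refl
  if-* false x y = R.zeroˡ y

  sum-weights : ∀ {k} (b : Vector Bool k) (x y : Vector Carrier k) →
    ∑[ i < k ] (- (2 · (if b i then x i else 0#)) * y i)
      ≈ - (2 · (∑[ i < k ] (if b i then x i * y i else 0#)))
  sum-weights {k} b x y = begin
    ∑[ i < k ] (- (2 · (if b i then x i else 0#)) * y i)  ≈⟨ sum-cong-≋ step ⟩
    ∑[ i < k ] (-2# * z i)                                ≈⟨ *-distribˡ-sum -2# z ⟨
    -2# * sum z                                           ≈⟨ -2·≈-2#* (sum z) ⟨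
    - (2 · sum z)                                         ∎
    where
    z : Vector Carrier k
    z i = if b i then x i * y i else 0#
    step : ∀ i → - (2 · (if b i then x i else 0#)) * y i ≈ -2# * z i
    step i = begin
      - (2 · (if b i then x i else 0#)) * y i  ≈⟨ R.*-congʳ (-2·≈-2#* _) ⟩
      -2# * (if b i then x i else 0#) * y i    ≈⟨ R.*-assoc _ _ _ ⟩
      -2# * ((if b i then x i else 0#) * y i)  ≈⟨ R.*-congˡ (if-* (b i) (x i) (y i)) ⟩
      -2# * z i                                ∎

  -- The recurrence for exp (-2 Σ aₙ uⁿ), where aₙ is wₙ/n for the n ≥ 1 that b
  -- selects and 0 for the other n ≥ 1.  Keeping the ring and the weights
  -- abstract prevents fractions from being unfolded during conversion checking.
  weighted-recurrence : (b : ℕ → Bool) (w : ∀ n → .{{_ : NonZero n}} → Carrier) (a : Series) →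
    (∀ n → a (suc n) ≈ (if b (suc n) then w (suc n) * ι (1ℤ ℚ./ suc n) else 0#)) →
    (e₀≈0 : (S.- (2 SMult.× a)) 0 ≈ 0#) → ∀ n →
    suc n · exp (S.- (2 SMult.× a)) e₀≈0 (suc n) ≈
      - (2 · (∑[ i < suc n ] (if b (suc (toℕ i))
          then w (suc (toℕ i)) * exp (S.- (2 SMult.× a)) e₀≈0 (n ∸ toℕ i) else 0#)))
  weighted-recurrence b w a a-suc e₀≈0 n = begin
    suc n · g (suc n)
      ≈⟨ exp-recurrence (S.- (2 SMult.× a)) e₀≈0 n ⟩
    ∑[ i < suc n ] (suc (toℕ i) · (- (2 · a (suc (toℕ i)))) * g (n ∸ toℕ i))
      ≈⟨ sum-cong-≋ {suc n} (λ i → R.*-congʳ {g (n ∸ toℕ i)} (weight (toℕ i))) ⟩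
    ∑[ i < suc n ] (- (2 · (if b (suc (toℕ i)) then w (suc (toℕ i)) else 0#)) * g (n ∸ toℕ i))
      ≈⟨ sum-weights {suc n} (λ i → b (suc (toℕ i))) (λ i → w (suc (toℕ i))) (λ i → g (n ∸ toℕ i)) ⟩
    - (2 · (∑[ i < suc n ] (if b (suc (toℕ i)) then w (suc (toℕ i)) * g (n ∸ toℕ i) else 0#))) ∎
    where
    g : Series
    g = exp (S.- (2 SMult.× a)) e₀≈0
    weight : ∀ k → suc k · (- (2 · a (suc k))) ≈ - (2 · (if b (suc k) then w (suc k) else 0#))
    weight k = R.trans (×-congʳ (suc k) (R.-‿cong (×-congʳ 2 (a-suc k))))
      (weight-exponent (suc k) (b (suc k)) (w (suc k)))

open import Algebra.Properties.Semiring.Mult 𝕂.semiring using () renaming (_×_ to _·_)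
open import Algebra.Properties.Semiring.Sum 𝕂.semiring using (sum-syntax)

proposition3p4 : (f 0 𝕂.≈ 𝕂.1#) ×
    (∀ (m : ℕ) → 1 ≤ m →
    m · f m 𝕂.≈
    𝕂.- (2 · (∑[ i < m ] (if isOdd (suc (toℕ i)) then ratio (suc (toℕ i)) 𝕂.* f (m ∸ suc (toℕ i)) else 𝕂.0#))))
proposition3p4 = f-zero , λ { (suc n) _ → recurrence n }
  where
  f-zero : f 0 𝕂.≈ 𝕂.1#
  f-zero = ExpRecurrence.exp-zero ℚ⟨t,s⟩.commutativeRing ι ι-homo exponent exponent₀≈0
  recurrence : ∀ n → suc n · f (suc n) 𝕂.≈
    𝕂.- (2 · (∑[ i < suc n ] (if isOdd (suc (toℕ i)) then ratio (suc (toℕ i)) 𝕂.* f (n ∸ toℕ i) else 𝕂.0#)))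
  recurrence = WeightedExponent.weighted-recurrence ℚ⟨t,s⟩.commutativeRing ι ι-homo
    isOdd (λ n → ratio n) oddSeries (λ n → 𝕂.refl) exponent₀≈0
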